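{- For every stable allocation instance with rational data and a feasible rational initial allocation, random better response dynamics terminate with a stable allocation with probability one.
   Context: A stable allocation instance consists of a bipartite graph $G=(V,E)$ with color classes $J$ (jobs, the active side) and $M$ (machines, the passive side), quotas $q:V\to\mathbb{R}_{\ge 0}$, edge capacities $c:E\to\mathbb{R}_{\ge 0}$, and for every vertex $v$ a strict ranking of its incident edges. An allocation is $x:E\to\mathbb{R}_{\ge0}$ with $x(e)\le c(e)$ for all $e$ and $x(v):=\sum_{e\in\delta(v)}x(e)\le q(v)$ for all $v$. An edge $jm$ blocks $x$ if (1) $x(jm)<c(jm)$; (2) $x(j)<q(j)$ or $j$ prefers $jm$ to its worst edge with positive value in $x$; (3) $x(m)<q(m)$ or $m$ prefers $jm$ to its worst edge with positive value in $x$. An allocation is stable if no edge blocks it. A better response step: a job $j$ chooses a blocking edge $jm$ and increases $x(jm)$; simultaneously $j$ and $m$ may decrease allocation only on edges that they rank worse than $jm$, so that the result is again feasible. In the rational case, let $u>0$ be the smallest positive number representable as an integer linear combination of all input data; better response steps are restricted to those changing edge values by multiples of $u$, so that the set of reachable allocations is finite. Random better response dynamics: as long as the current allocation is unstable, the next step is chosen at random among all such (restricted) better response steps, every available step having positive probability (a discrete-time Markov chain on the finite set of reachable allocations, with stable allocations absorbing).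
   Formalization: The transition probabilities of the random better response dynamics are taken to be rational numbers, whereas the statement allows arbitrary positive real probabilities. -}

module Defs where

open import Data.Nat as ℕ using (ℕ; zero; suc)
open import Data.Integer as ℤ using (ℤ; +_)
open import Data.Rational using (ℚ; _+_; _*_; _-_; _/_; _≤_; _<_; 0ℚ; 1ℚ)
open import Data.Fin using (Fin; zero; suc)
open import Data.List using (List; []; _∷_)
open import Data.List.Membership.Propositional using (_∈_)
open import Data.List.Relation.Unary.All using (All)
open import Data.Product using (Σ; ∃; ∃-syntax; _×_; _,_; proj₁; proj₂)
open import Data.Sum using (_⊎_)
open import Relation.Binary.PropositionalEquality using (_≡_; _≢_)
open import Relation.Nullary using (¬_)

Σᶠ : ∀ n → (Fin n → ℚ) → ℚ
Σᶠ zero    f = 0ℚ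
Σᶠ (suc n) f = f zero + Σᶠ n (λ i → f (suc i))

ι : ℤ → ℚ
ι z = z / 1

-- Stable allocation instances
--
-- Jobs are Fin nJ, machines Fin nM, edges Fin nE.  Each edge e joins
-- job (jobOf e) and machine (machOf e); the graph is simple (no two
-- edges with the same endpoints).  Rankings: rankJ e is the position
-- of e in the ranking of its job (smaller = more preferred), and it is
-- injective on the edges incident to one job (strict ranking);
-- likewise rankM for machines.

record Instance : Set where
  field
    nJ nM nE : ℕ
    jobOf  : Fin nE → Fin nJ
    machOf : Fin nE → Fin nM
    simple : ∀ e f → jobOf e ≡ jobOf f → machOf e ≡ machOf f → e ≡ f
    qJ     : Fin nJ → ℚ
    qM     : Fin nM → ℚ
    cap    : Fin nE → ℚ
    qJ≥0   : ∀ j → 0ℚ ≤ qJ j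
    qM≥0   : ∀ m → 0ℚ ≤ qM m
    cap≥0  : ∀ e → 0ℚ ≤ cap e
    rankJ  : Fin nE → ℕ
    rankM  : Fin nE → ℕ
    rankJ-strict : ∀ e f → jobOf e ≡ jobOf f → rankJ e ≡ rankJ f → e ≡ f
    rankM-strict : ∀ e f → machOf e ≡ machOf f → rankM e ≡ rankM f → e ≡ f

module _ (I : Instance) where
  open Instance I

  Allocation : Set
  Allocation = Fin nE → ℚ

  -- job j (resp. machine m) prefers edge e to edge f (both incident to it)
  J-prefers : Fin nE → Fin nE → Set
  J-prefers e f = rankJ e ℕ.< rankJ f

  M-prefers : Fin nE → Fin nE → Set
  M-prefers e f = rankM e ℕ.< rankM f

  loadJ : Allocation → Fin nJ → ℚ
  loadJ x j = Σᶠ nE (λ e → indJ e)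
    where
      indJ : Fin nE → ℚ
      indJ e with jobOf e Data.Fin.≟ j
      ... | Relation.Nullary.yes _ = x e
      ... | Relation.Nullary.no  _ = 0ℚ

  loadM : Allocation → Fin nM → ℚ
  loadM x m = Σᶠ nE (λ e → indM e)
    where
      indM : Fin nE → ℚ
      indM e with machOf e Data.Fin.≟ m
      ... | Relation.Nullary.yes _ = x e
      ... | Relation.Nullary.no  _ = 0ℚ

  Feasible : Allocation → Set
  Feasible x = (∀ e → 0ℚ ≤ x e × x e ≤ cap e)
             × (∀ j → loadJ x j ≤ qJ j)
             × (∀ m → loadM x m ≤ qM m)

  -- "the job of e prefers e to its worst edge with positive value in x":
  -- some edge f of that job with x(f) > 0 is ranked worse than e
  -- (equivalently, the worst positive edge is ranked worse than e).
  J-prefers-to-worst : Allocation → Fin nE → Set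
  J-prefers-to-worst x e =
    Σ (Fin nE) λ f → (jobOf f ≡ jobOf e × 0ℚ < x f × J-prefers e f)

  M-prefers-to-worst : Allocation → Fin nE → Set
  M-prefers-to-worst x e =
    Σ (Fin nE) λ f → (machOf f ≡ machOf e × 0ℚ < x f × M-prefers e f)

  Blocks : Fin nE → Allocation → Set
  Blocks e x = x e < cap e
             × (loadJ x (jobOf e) < qJ (jobOf e) ⊎ J-prefers-to-worst x e)
             × (loadM x (machOf e) < qM (machOf e) ⊎ M-prefers-to-worst x e)

  Stable : Allocation → Set
  Stable x = ∀ e → ¬ Blocks e x

  MultipleOf : ℚ → ℚ → Set
  MultipleOf u r = Σ ℤ λ k → r ≡ ι k * u

  BetterResponse : ℚ → Allocation → Allocation → Set
  BetterResponse u x y = Σ (Fin nE) λ e →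
      ( Blocks e x
      × x e < y e
      × (∀ f → f ≢ e → jobOf f ≡ jobOf e →
            y f ≤ x f × (y f ≢ x f → J-prefers e f))
      × (∀ f → f ≢ e → machOf f ≡ machOf e →
            y f ≤ x f × (y f ≢ x f → M-prefers e f))
      × (∀ f → jobOf f ≢ jobOf e → machOf f ≢ machOf e → y f ≡ x f)
      × (∀ f → MultipleOf u (y f - x f))
      × Feasible y )

  data Reachable (u : ℚ) (x₀ : Allocation) : Allocation → Set where
    start : Reachable u x₀ x₀
    step  : ∀ {x y} → Reachable u x₀ x → BetterResponse u x y → Reachable u x₀ y

  IntegerCombination : Allocation → ℚ → Set
  IntegerCombination x₀ r =
    Σ (Fin nJ → ℤ) λ a → Σ (Fin nM → ℤ) λ b → Σ (Fin nE → ℤ) λ c → Σ (Fin nE → ℤ) λ d →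
      r ≡ Σᶠ nJ (λ j → ι (a j) * qJ j)
        + Σᶠ nM (λ m → ι (b m) * qM m)
        + Σᶠ nE (λ e → ι (c e) * cap e)
        + Σᶠ nE (λ e → ι (d e) * x₀ e)

  IsStepUnit : Allocation → ℚ → Set
  IsStepUnit x₀ u =
    0ℚ < u × IntegerCombination x₀ u
    × (∀ r → 0ℚ < r → IntegerCombination x₀ r → u ≤ r)

Kernel : Instance → Set
Kernel I = Allocation I → List (Allocation I × ℚ)

sumProb : {A : Set} → List (A × ℚ) → ℚ
sumProb []             = 0ℚ
sumProb ((_ , p) ∷ ps) = p + sumProb ps

IsRandomBRD : (I : Instance) → ℚ → Allocation I → Kernel I → Set
IsRandomBRD I u x₀ K =
  ∀ x → Reachable I u x₀ x →
      All (λ yp → BetterResponse I u x (proj₁ yp) × 0ℚ < proj₂ yp) (K x)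
    × (∀ y → BetterResponse I u x y → Σ ℚ λ p → (y , p) ∈ K x)
    × (K x ≢ [] → sumProb (K x) ≡ 1ℚ)

runningProb : (I : Instance) → Kernel I → ℕ → Allocation I → ℚ
runningProb I K zero    x = 1ℚ
runningProb I K (suc n) x = go (K x)
  where
    go : List (Allocation I × ℚ) → ℚ
    go []             = 0ℚ
    go ((y , p) ∷ ps) = p * runningProb I K n y + go ps

TerminatesAlmostSurely : (I : Instance) → ℚ → Allocation I → Kernel I → Set
TerminatesAlmostSurely I u x₀ K =
    (∀ ε → 0ℚ < ε → Σ ℕ λ N → runningProb I K N x₀ < ε)
  × (∀ x → Reachable I u x₀ x → (∀ y → ¬ BetterResponse I u x y) → Stable I x)

{-# OPTIONS --safe #-}
-- All data and all reachable values are multiples of u, so allocations are integer vectors, and it suffices to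
-- move single units. From any allocation a stable one is reached in boundedly many steps:
--   * while some blocking edge e has a job with a worse used edge f, move a unit from f to e; Σ rankJ · x drops;
--   * afterwards every blocking edge has a job with free quota. Raise the blocking edge of minimal rankJ and let
--     a saturated machine drop its worst used edge. No job then wants to move units, and the machines
--     only gain: Σ (R − rankM) · x rises, where R exceeds all ranks.
-- Only finitely many allocations are reachable, hence the step probabilities are at least some δ > 0, and within
-- each period of L + 1 steps the probability of still running shrinks by the factor 1 − δ^L.
module Submission where

open import Defs
open import Data.Rational using (ℚ)
open import Data.Bool using (Bool; true; false; if_then_else_)
open import Data.Fin using (Fin; zero; suc; _≟_)
open import Data.List using (List; []; _∷_; map; concatMap; cartesianProductWith; upTo)
open import Data.List.Membership.Propositional using (_∈_; lose)
open import Data.List.Membership.Propositional.Properties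
  using (∈-map⁺; ∈-concatMap⁺; ∈-cartesianProductWith⁺; ∈-upTo⁺)
open import Data.List.Relation.Unary.All as All using (All)
open import Data.List.Relation.Unary.Any using (here; there)
open import Data.Nat as ℕ using (ℕ; zero; suc)
import Data.Nat.Properties as ℕ
open import Data.Product using (∃; ∃₂; _×_; _,_; proj₁; proj₂)
open import Data.Sum as Sum using (_⊎_; inj₁; inj₂; [_,_]′)
import Data.Vec.Functional as Vector
open import Function using (_∘_; case_of_)
open import Relation.Binary.PropositionalEquality
open import Relation.Nullary

module IntegralMarket where
  open import Algebra.Properties.CommutativeSemigroup ℕ.+-commutativeSemigroup using (x∙yz≈y∙xz)
  open import Data.Empty using (⊥)
  open import Data.Fin.Properties using (any?)
  open import Data.Maybe using (Maybe; just; nothing)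
  open import Data.Nat hiding (_≟_)
  open import Data.Nat.Induction using (<-rec)
  open import Data.Nat.Properties hiding (_≟_)
  open import Data.Vec.Functional using (updateAt)
  open import Data.Vec.Functional.Properties using (updateAt-updates; updateAt-minimal)
  open import Relation.Nullary.Decidable using (_×-dec_; _⊎-dec_; dec-true; dec-false)
  open import Relation.Unary using (Decidable)

  -- Minima and maxima over finite index sets.

  bounded : ∀ {n} (μ : Fin n → ℕ) → ∃ λ R → ∀ i → μ i < R
  bounded {zero}  μ = 0 , λ ()
  bounded {suc n} μ with bounded (μ ∘ suc)
  ... | R , μ<R = suc (μ zero) + R , λ where
    zero    → m≤m+n _ R
    (suc i) → <-≤-trans (μ<R i) (m≤n+m R (suc (μ zero)))

  -- Well-founded descent on `μ i`: any element of `P` with a smaller value restarts the search.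
  argmin : ∀ {n} {P : Fin n → Set} → Decidable P → (μ : Fin n → ℕ) → ∃ P →
           ∃ λ i → P i × (∀ j → P j → μ i ≤ μ j)
  argmin {P = P} P? μ (i , p) = <-rec Goal search (μ i) i refl p
    where
    Goal : ℕ → Set
    Goal m = ∀ i → μ i ≡ m → P i → ∃ λ i → P i × (∀ j → P j → μ i ≤ μ j)
    search : ∀ m → (∀ {m′} → m′ < m → Goal m′) → Goal m
    search m rec i refl p with any? (λ j → P? j ×-dec (μ j <? μ i))
    ... | yes (j , pj , lt) = rec lt j refl pj
    ... | no ¬better        = i , p , λ j pj → ≮⇒≥ λ lt → ¬better (j , pj , lt)

  -- Reflecting `μ` below a strict bound `R` exchanges maxima and minima; no difference is
  -- truncated.
  argmax : ∀ {n} {P : Fin n → Set} → Decidable P → (μ : Fin n → ℕ) → ∃ P →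
           ∃ λ i → P i × (∀ j → P j → μ j ≤ μ i)
  argmax P? μ ex with bounded μ
  ... | R , μ<R with argmin P? (λ i → R ∸ μ i) ex
  ...   | i , p , min = i , p , λ j pj → ≮⇒≥ λ lt → <⇒≱ (∸-monoʳ-< lt (<⇒≤ (μ<R j))) (min j pj)

  -- Weighted sums, serving both as loads and as potentials.

  weigh : ∀ {n} → (Fin n → ℕ) → (Fin n → ℕ) → ℕ
  weigh {zero}  w k = 0
  weigh {suc n} w k = w zero * k zero + weigh (w ∘ suc) (k ∘ suc)

  weigh-mono : ∀ {n} (w : Fin n → ℕ) {k l} → (∀ i → k i ≤ l i) → weigh w k ≤ weigh w l
  weigh-mono {zero}  w k≤l = z≤n
  weigh-mono {suc n} w k≤l = +-mono-≤ (*-monoʳ-≤ (w zero) (k≤l zero)) (weigh-mono (w ∘ suc) (k≤l ∘ suc))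

  weigh-inc : ∀ {n} (w k : Fin n → ℕ) e → weigh w (updateAt k e suc) ≡ w e + weigh w k
  weigh-inc w k zero    = trans (cong (_+ weigh (w ∘ suc) (k ∘ suc)) (*-suc (w zero) (k zero))) (+-assoc (w zero) _ _)
  weigh-inc w k (suc e) = trans (cong (w zero * k zero +_) (weigh-inc (w ∘ suc) (k ∘ suc) e))
                                (x∙yz≈y∙xz (w zero * k zero) (w (suc e)) _)

  weigh-dec : ∀ {n} (w k : Fin n → ℕ) e → 0 < k e → w e + weigh w (updateAt k e pred) ≡ weigh w k
  weigh-dec w k zero 0<k with k zero
  ... | suc m = trans (sym (+-assoc (w zero) _ _)) (cong (_+ weigh (w ∘ suc) (k ∘ suc)) (sym (*-suc (w zero) m)))
  weigh-dec w k (suc e) 0<k =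
    trans (x∙yz≈y∙xz (w (suc e)) (w zero * k zero) _) (cong (w zero * k zero +_) (weigh-dec (w ∘ suc) (k ∘ suc) e 0<k))

  -- One side of the market: loads, acceptance, making room.

  record Side (n : ℕ) : Set where
    field
      {size} : ℕ
      end    : Fin n → Fin size
      quota  : Fin size → ℕ
      rank   : Fin n → ℕ

    -- Indicator weights in Boolean form, so that `Σ-scaled` later applies to the loads
    -- definitionally.
    share : Fin size → Fin n → ℕ
    share v e = if does (end e ≟ v) then 1 else 0

    load : (Fin n → ℕ) → Fin size → ℕ
    load k v = weigh (share v) k

    Displaceable : (Fin n → ℕ) → Fin n → Fin n → Set
    Displaceable k e f = end f ≡ end e × 0 < k f × rank e < rank f

    Accepts : (Fin n → ℕ) → Fin n → Set
    Accepts k e = load k (end e) < quota (end e) ⊎ ∃ (Displaceable k e)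

    -- The index records which edge gives up a unit so that one unit of `e` fits on this side;
    -- `nothing` means that free quota suffices.
    data MakesRoom (k : Fin n → ℕ) (e : Fin n) : Maybe (Fin n) → Set where
      spare    : load k (end e) < quota (end e) → MakesRoom k e nothing
      displace : ∀ {f} → Displaceable k e f → MakesRoom k e (just f)

    displaceable? : ∀ k e → Decidable (Displaceable k e)
    displaceable? k e f = (end f ≟ end e) ×-dec (0 <? k f) ×-dec (rank e <? rank f)

    accepts? : ∀ k → Decidable (Accepts k)
    accepts? k e = (load k (end e) <? quota (end e)) ⊎-dec any? (displaceable? k e)

    makeRoom : ∀ {k e} → Accepts k e → ∃ (MakesRoom k e)
    makeRoom (inj₁ lt)      = nothing , spare lt
    makeRoom (inj₂ (f , d)) = just f , displace d

    makesRoom⇒accepts : ∀ {k e a} → MakesRoom k e a → Accepts k e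
    makesRoom⇒accepts (spare lt)   = inj₁ lt
    makesRoom⇒accepts (displace d) = inj₂ (_ , d)

    share-own : ∀ {e v} → end e ≡ v → share v e ≡ 1
    share-own {e} {v} eq = cong (if_then 1 else 0) (dec-true (end e ≟ v) eq)

    share-other : ∀ {e v} → end e ≢ v → share v e ≡ 0
    share-other {e} {v} ne = cong (if_then 1 else 0) (dec-false (end e ≟ v) ne)

  open Side using (spare; displace)

  -- Removing and adding single units.

  drop : ∀ {n} → Maybe (Fin n) → (Fin n → ℕ) → Fin n → ℕ
  drop nothing  k = k
  drop (just f) k = updateAt k f pred

  insert : ∀ {n} → Fin n → (Fin n → ℕ) → Fin n → ℕ
  insert e k = updateAt k e suc

  insert-≤ : ∀ {n} {k l : Fin n → ℕ} e → (∀ i → k i ≤ l i) → ∀ {i} → i ≢ e → insert e k i ≤ l i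
  insert-≤ {k = k} e k≤l {i} i≢e = ≤-trans (≤-reflexive (updateAt-minimal i e k i≢e)) (k≤l i)

  drop-≤ : ∀ {n} a (k : Fin n → ℕ) i → drop a k i ≤ k i
  drop-≤ nothing  k i = ≤-refl
  drop-≤ (just f) k i with i ≟ f
  ... | yes refl = ≤-trans (≤-reflexive (updateAt-updates f k)) pred[n]≤n
  ... | no i≢f   = ≤-reflexive (updateAt-minimal i f k i≢f)

  drop-mono : ∀ {n} a {k l : Fin n → ℕ} → (∀ i → k i ≤ l i) → ∀ i → drop a k i ≤ drop a l i
  drop-mono nothing  k≤l i = k≤l i
  drop-mono (just f) {k} {l} k≤l i with i ≟ f
  ... | yes refl = subst₂ _≤_ (sym (updateAt-updates f k)) (sym (updateAt-updates f l)) (pred-mono-≤ (k≤l f))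
  ... | no i≢f   = subst₂ _≤_ (sym (updateAt-minimal i f k i≢f)) (sym (updateAt-minimal i f l i≢f)) (k≤l i)

  drop-changes : ∀ {n} a (k : Fin n → ℕ) {i} → drop a k i ≢ k i → a ≡ just i
  drop-changes nothing  k ne = contradiction refl ne
  drop-changes (just f) k {i} ne with f ≟ i
  ... | yes refl = refl
  ... | no f≢i   = contradiction (updateAt-minimal i f k (f≢i ∘ sym)) ne

  drop₂-changes : ∀ {n} a b (k : Fin n → ℕ) {i} → drop a (drop b k) i ≢ k i → a ≡ just i ⊎ b ≡ just i
  drop₂-changes a b k {i} ne with drop b k i ℕ.≟ k i
  ... | no ne′ = inj₂ (drop-changes b k ne′)
  ... | yes eq = inj₁ (drop-changes a (drop b k) λ eq′ → ne (trans eq′ eq))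

  module _ {n} (S : Side n) where
    open Side S

    room-prefers : ∀ {k e a f} → MakesRoom k e a → a ≡ just f → end f ≡ end e × rank e < rank f
    room-prefers (displace (same , _ , lt)) refl = same , lt

    -- The other side may give up a unit too, so `z` only has to lie below `drop a k`. At the
    -- endpoint of `e` the spare or freed unit pays for the inserted one; at every other vertex the
    -- load cannot grow.
    quota-kept : ∀ {k e a z} → MakesRoom k e a → (∀ v → load k v ≤ quota v) →
                 (∀ i → z i ≤ drop a k i) → ∀ v → load (insert e z) v ≤ quota v
    quota-kept {k} {e} {a} {z} room ok z≤ v with end e ≟ v
    ... | no ne = begin
      load (insert e z) v      ≡⟨ weigh-inc (share v) z e ⟩
      share v e + load z v     ≡⟨ cong (_+ load z v) (share-other ne) ⟩
      load z v                 ≤⟨ weigh-mono (share v) (λ i → ≤-trans (z≤ i) (drop-≤ a k i)) ⟩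
      load k v                 ≤⟨ ok v ⟩
      quota v                  ∎
      where open ≤-Reasoning
    ... | yes refl = begin
      load (insert e z) v      ≡⟨ weigh-inc (share v) z e ⟩
      share v e + load z v     ≡⟨ cong (_+ load z v) (share-own {e} refl) ⟩
      suc (load z v)           ≤⟨ s≤s (weigh-mono (share v) z≤) ⟩
      suc (load (drop a k) v)  ≤⟨ fits room ⟩
      quota v                  ∎
      where
      open ≤-Reasoning
      fits : ∀ {a} → MakesRoom k e a → suc (load (drop a k) (end e)) ≤ quota (end e)
      fits (spare lt) = lt
      fits (displace {f} (same , pos , _)) = begin
        suc (load (drop (just f) k) (end e))                ≡⟨ cong (_+ load (drop (just f) k) (end e)) (share-own same) ⟨
        share (end e) f + load (drop (just f) k) (end e)    ≡⟨ weigh-dec (share (end e)) k f pos ⟩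
        load k (end e)                                      ≤⟨ ok (end e) ⟩
        quota (end e)                                       ∎

  record Market : Set where
    field
      {edges}       : ℕ
      jobs machines : Side edges
      cap           : Fin edges → ℕ
    module J = Side jobs
    module M = Side machines
    field
      simple : ∀ e f → J.end e ≡ J.end f → M.end e ≡ M.end f → e ≡ f

  -- Better responses on integer allocations.

  module Dynamics (market : Market) where
    open Market market public

    State : Set
    State = Fin edges → ℕ

    record Feasibleℕ (k : State) : Set where
      constructor feasible
      field
        capacity : ∀ e → k e ≤ cap e
        quotaJ   : ∀ j → J.load k j ≤ J.quota j
        quotaM   : ∀ m → M.load k m ≤ M.quota m
    open Feasibleℕ public

    Blocksℕ : State → Fin edges → Set
    Blocksℕ k e = k e < cap e × J.Accepts k e × M.Accepts k e

    blocks? : ∀ k → Decidable (Blocksℕ k)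
    blocks? k e = (k e <? cap e) ×-dec J.accepts? k e ×-dec M.accepts? k e

    record Step (k k′ : State) : Set where
      field
        edge     : Fin edges
        blocks   : Blocksℕ k edge
        raises   : k edge < k′ edge
        lowersJ  : ∀ f → f ≢ edge → J.end f ≡ J.end edge →
                   k′ f ≤ k f × (k′ f ≢ k f → J.rank edge < J.rank f)
        lowersM  : ∀ f → f ≢ edge → M.end f ≡ M.end edge →
                   k′ f ≤ k f × (k′ f ≢ k f → M.rank edge < M.rank f)
        keeps    : ∀ f → J.end f ≢ J.end edge → M.end f ≢ M.end edge → k′ f ≡ k f
        remains  : Feasibleℕ k′

    exchange : Fin edges → Maybe (Fin edges) → Maybe (Fin edges) → State → State
    exchange e a b k = insert e (drop a (drop b k))

    -- Simplicity separates the two sides: an edge dropped by the machine that also shares the job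
    -- of `e` would be parallel to `e`, hence equal to it. So each side sees only its own drop,
    -- which ranks below `e`.
    exchange-step : ∀ {k e a b} → Feasibleℕ k → k e < cap e →
                    J.MakesRoom k e a → M.MakesRoom k e b → Step k (exchange e a b k)
    exchange-step {k} {e} {a} {b} F e<cap roomJ roomM = record
      { edge    = e
      ; blocks  = e<cap , J.makesRoom⇒accepts roomJ , M.makesRoom⇒accepts roomM
      ; raises  = ≤-reflexive (sym (trans (updateAt-updates e z) (cong suc ze≡ke)))
      ; lowersJ = λ f f≢e same → insert-≤ e z≤k f≢e , λ ne →
          [ (λ eq → proj₂ (room-prefers jobs roomJ eq))
          , (λ eq → contradiction (simple f e same (proj₁ (room-prefers machines roomM eq))) f≢e)
          ]′ (changed f≢e ne)
      ; lowersM = λ f f≢e same → insert-≤ e z≤k f≢e , λ ne →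
          [ (λ eq → contradiction (simple f e (proj₁ (room-prefers jobs roomJ eq)) same) f≢e)
          , (λ eq → proj₂ (room-prefers machines roomM eq))
          ]′ (changed f≢e ne)
      ; keeps   = λ f offJ offM → decidable-stable (_ ℕ.≟ _) λ ne →
          [ (λ eq → offJ (proj₁ (room-prefers jobs roomJ eq)))
          , (λ eq → offM (proj₁ (room-prefers machines roomM eq)))
          ]′ (changed (λ f≡e → offJ (cong J.end f≡e)) ne)
      ; remains = feasible capacity′
          (quota-kept jobs roomJ (quotaJ F) (drop-mono a (drop-≤ b k)))
          (quota-kept machines roomM (quotaM F) (drop-≤ a (drop b k)))
      }
      where
      z : State
      z = drop a (drop b k)
      z≤k : ∀ i → z i ≤ k i
      z≤k i = ≤-trans (drop-≤ a (drop b k) i) (drop-≤ b k i)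
      changed : ∀ {f} → f ≢ e → insert e z f ≢ k f → a ≡ just f ⊎ b ≡ just f
      changed {f} f≢e ne = drop₂-changes a b k λ eq → ne (trans (updateAt-minimal f e z f≢e) eq)
      -- A dropped edge ranks strictly worse than `e`, so it is not `e` itself.
      ze≡ke : z e ≡ k e
      ze≡ke = decidable-stable (_ ℕ.≟ _) λ ne →
        [ (λ eq → <-irrefl refl (proj₂ (room-prefers jobs roomJ eq)))
        , (λ eq → <-irrefl refl (proj₂ (room-prefers machines roomM eq))) ]′ (drop₂-changes a b k ne)
      capacity′ : ∀ i → insert e z i ≤ cap i
      capacity′ i with i ≟ e
      ... | yes refl = ≤-trans (≤-reflexive (updateAt-updates e z)) (≤-<-trans (z≤k e) e<cap)
      ... | no i≢e   = ≤-trans (insert-≤ e z≤k i≢e) (capacity F i)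

    blocked⇒step : ∀ {k e} → Feasibleℕ k → Blocksℕ k e → ∃ (Step k)
    blocked⇒step F (e<cap , accJ , accM) =
      _ , exchange-step F e<cap (proj₂ (J.makeRoom accJ)) (proj₂ (M.makeRoom accM))

    -- The index is only an upper bound on the length, hence `stop` at every `n`.
    data PathToStable : ℕ → State → Set where
      stop : ∀ {n k} → (∀ e → ¬ Blocksℕ k e) → PathToStable n k
      go   : ∀ {n k k′} → Step k k′ → PathToStable n k′ → PathToStable (suc n) k

    -- In contrast to `Blocksℕ`, free quota of the job does not count: the job must move a unit away
    -- from a worse used edge.
    Improvable : State → Fin edges → Set
    Improvable k e = k e < cap e × ∃ (J.Displaceable k e) × M.Accepts k e

    improvable? : ∀ k → Decidable (Improvable k)
    improvable? k e = (k e <? cap e) ×-dec any? (J.displaceable? k e) ×-dec M.accepts? k e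

    Content : State → Set
    Content k = ∀ e → ¬ Improvable k e

    -- Saturation phase: jobs only use free quota, machines only gain.

    module Saturation where
      R : ℕ
      R = proj₁ (bounded M.rank)

      merit : Fin edges → ℕ
      merit e = R ∸ M.rank e

      rank<R : ∀ e → M.rank e < R
      rank<R = proj₂ (bounded M.rank)

      private
        module _ {k e} (e<cap : k e < cap e) (freeJ : J.load k (J.end e) < J.quota (J.end e))
                 (content : Content k) (best : ∀ e′ → Blocksℕ k e′ → J.rank e ≤ J.rank e′) where

          -- An edge that has just lost a unit is below its capacity, but not wanted back, since it was the
          -- worst used edge of its saturated machine.
          preserved : ∀ {b} → M.MakesRoom k e b → (∀ f → b ≡ just f → M.load k (M.end e) ≮ M.quota (M.end e)) →
                      (∀ f → b ≡ just f → ∀ h → M.Displaceable k e h → M.rank h ≤ M.rank f) →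
                      Content (insert e (drop b k))
          preserved {b} room full worst e′ (e′<cap , (f , same , pos , lt) , acc) = refute (f ≟ e)
            where
            k′ : State
            k′ = insert e (drop b k)

            was-used : ∀ {h} → h ≢ e → 0 < k′ h → 0 < k h
            was-used h≢e pos = <-≤-trans pos (insert-≤ e (drop-≤ b k) h≢e)

            -- The displaced edge lies at the machine of `e`, so a displacement leaves all machine
            -- loads unchanged; a plain insertion raises one of them.
            load-≤ : ∀ {b} → M.MakesRoom k e b → ∀ m → M.load k m ≤ M.load (insert e (drop b k)) m
            load-≤ (spare _) m = ≤-trans (m≤n+m _ _) (≤-reflexive (sym (weigh-inc (M.share m) k e)))
            load-≤ (displace {g} (same , pos , _)) m = ≤-reflexive (begin
              M.load k m                                     ≡⟨ weigh-dec (M.share m) k g pos ⟨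
              M.share m g + M.load (drop (just g) k) m       ≡⟨ cong (λ v → (if does (v ≟ m) then 1 else 0) + kept) same ⟩
              M.share m e + M.load (drop (just g) k) m       ≡⟨ weigh-inc (M.share m) (drop (just g) k) e ⟨
              M.load (insert e (drop (just g) k)) m          ∎)
              where
              open ≡-Reasoning
              kept : ℕ
              kept = M.load (drop (just g) k) m

            -- If the worse used edge is the newly raised `e`, then before the step the machine
            -- either had free quota or used the displaced edge, which is worse still.
            accepted-before : ∀ {e′} → M.Accepts k′ e′ → M.Accepts k e′
            accepted-before (inj₁ lt) = inj₁ (≤-<-trans (load-≤ room _) lt)
            accepted-before {e′} (inj₂ (h , same , pos , lt)) with h ≟ e
            ... | no h≢e   = inj₂ (h , same , was-used h≢e pos , lt)
            ... | yes refl = via room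
              where
              via : ∀ {b} → M.MakesRoom k e b → M.Accepts k e′
              via (spare free) = inj₁ (subst (λ m → M.load k m < M.quota m) same free)
              via (displace {g} (same′ , pos′ , lt′)) = inj₂ (g , trans same′ same , pos′ , <-trans lt lt′)

            not-wanted-back : ∀ {g} → b ≡ just g → M.Displaceable k e g → ¬ M.Accepts k′ g
            not-wanted-back refl (same , _ , _) (inj₁ lt) =
              full _ refl (subst (λ m → M.load k m < M.quota m) same (≤-<-trans (load-≤ room _) lt))
            not-wanted-back refl (same , pos , lt) (inj₂ (h , same′ , pos′ , lt′)) =
              <⇒≱ lt′ (worst _ refl h (trans same′ same , was-used h≢e pos′ , <-trans lt lt′))
              where
              h≢e : h ≢ e
              h≢e refl = <-asym lt lt′

            below-cap : k e′ < cap e′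
            below-cap with e′ ≟ e
            ... | yes refl = e<cap
            ... | no e′≢e with drop b k e′ ℕ.≟ k e′
            ...   | yes eq = subst (_< cap e′) (trans (updateAt-minimal e′ e (drop b k) e′≢e) eq) e′<cap
            ...   | no ne  = contradiction acc (not-wanted-back lost (displaced room lost))
              where
              lost : b ≡ just e′
              lost = drop-changes b k ne
              displaced : ∀ {b} → M.MakesRoom k e b → b ≡ just e′ → M.Displaceable k e e′
              displaced (displace d) refl = d

            refute : Dec (f ≡ e) → ⊥
            refute (no f≢e)   = content e′ (below-cap , (f , same , was-used f≢e pos , lt) , accepted-before acc)
            -- Here `e′` would be a blocking edge of the job of `e`, which has free quota, and rank
            -- above `e`, against the choice of `e`.
            refute (yes refl) = <⇒≱ lt (best e′
              (below-cap , inj₁ (subst (λ j → J.load k j < J.quota j) same freeJ) , accepted-before acc))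

          -- With free quota at the machine the potential gains `merit e`, positive since `R`
          -- exceeds all ranks; otherwise a unit passes from a worse edge to `e`.
          saturate : Feasibleℕ k → M.Accepts k e →
                     ∃ λ k′ → Step k k′ × Content k′ × weigh merit k < weigh merit k′
          saturate F acc with M.load k (M.end e) <? M.quota (M.end e)
          ... | yes free = _ , exchange-step F e<cap (spare freeJ) (spare free)
                         , preserved (spare free) (λ _ ()) (λ _ ())
                         , ≤-trans (+-monoˡ-≤ _ (m<n⇒0<n∸m (rank<R e))) (≤-reflexive (sym (weigh-inc merit k e)))
          ... | no full with acc
          ...   | inj₁ free = contradiction free full
          -- Dropping the worst used edge, rather than any displaceable one, is what `preserved`
          -- relies on.
          ...   | inj₂ ex with argmax (M.displaceable? k e) M.rank ex
          ...     | g , d@(_ , pos , lt) , worst =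
                     _ , exchange-step F e<cap (spare freeJ) (displace d)
                   , preserved (displace d) (λ _ _ → full) (λ where _ refl → worst)
                   , (begin-strict
                        weigh merit k                        ≡⟨ weigh-dec merit k g pos ⟨
                        merit g + weigh merit (drop (just g) k)     <⟨ +-monoˡ-< _ (∸-monoʳ-< lt (<⇒≤ (rank<R g))) ⟩
                        merit e + weigh merit (drop (just g) k)     ≡⟨ weigh-inc merit (drop (just g) k) e ⟨
                        weigh merit (insert e (drop (just g) k)) ∎)
            where open ≤-Reasoning

      -- Induction on `n`, which bounds how far the merit of `k` is below that of the capacity
      -- vector, a maximum over all feasible states.
      saturation : ∀ n {k} → Feasibleℕ k → Content k → weigh merit cap ≤ n + weigh merit k → PathToStable n k
      saturation n {k} F content bound with any? (blocks? k)
      ... | no ¬b = stop λ e b → ¬b (e , b)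
      ... | yes ex with argmin (blocks? k) J.rank ex
      -- In a content state the job of a blocking edge can only have free quota.
      ...   | e , (e<cap , inj₂ imp , accM) , _ = contradiction (e<cap , imp , accM) (content e)
      ...   | e , (e<cap , inj₁ freeJ , accM) , best with saturate e<cap freeJ content best F accM
      ...     | k′ , st , content′ , lt with n
      ...       | zero  = contradiction (weigh-mono merit (capacity (Step.remains st))) (<⇒≱ (≤-<-trans bound lt))
      ...       | suc n = go st (saturation n (Step.remains st) content′
                            (≤-trans bound (≤-trans (≤-reflexive (sym (+-suc n _))) (+-monoʳ-≤ n lt))))

    -- Improvement phase, followed by saturation.

    open Saturation

    -- `n` bounds the remaining improvement steps; the other summand is reserved for the saturation
    -- phase.
    improvement : ∀ n {k} → Feasibleℕ k → weigh J.rank k ≤ n → PathToStable (n + weigh merit cap) k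
    improvement n {k} F bound with any? (improvable? k)
    ... | no ¬i = weaken n (saturation _ F (λ e i → ¬i (e , i)) (m≤m+n _ _))
      where
      weaken : ∀ m {n k} → PathToStable n k → PathToStable (m + n) k
      weaken m (stop s) = stop s
      weaken m {suc n} {k} (go st p) = subst (λ n → PathToStable n k) (sym (+-suc m n)) (go st (weaken m p))
    ... | yes (e , e<cap , (f , d@(_ , pos , lt)) , acc) with M.makeRoom acc
    ...   | b , room = continue n bound
      where
      open ≤-Reasoning
      k′ : State
      k′ = exchange e (just f) b k
      st : Step k k′
      st = exchange-step F e<cap (displace d) room
      drop-drop-≤ : ∀ i → drop (just f) (drop b k) i ≤ drop (just f) k i
      drop-drop-≤ = drop-mono (just f) (drop-≤ b k)
      -- Moving the unit from `f` to `e` lowers the sum strictly; a unit dropped by the machine can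
      -- only lower it further.
      drops : weigh J.rank k′ < weigh J.rank k
      drops = begin-strict
        weigh J.rank k′                                          ≡⟨ weigh-inc J.rank (drop (just f) (drop b k)) e ⟩
        J.rank e + weigh J.rank (drop (just f) (drop b k))       <⟨ +-monoˡ-< _ lt ⟩
        J.rank f + weigh J.rank (drop (just f) (drop b k))       ≤⟨ +-monoʳ-≤ (J.rank f) (weigh-mono J.rank drop-drop-≤) ⟩
        J.rank f + weigh J.rank (drop (just f) k)                ≡⟨ weigh-dec J.rank k f pos ⟩
        weigh J.rank k                                           ∎
      continue : ∀ n → weigh J.rank k ≤ n → PathToStable (n + weigh merit cap) k
      continue zero    bound = contradiction (<-≤-trans drops bound) λ ()
      continue (suc n) bound = go st (improvement n (Step.remains st) (≤-pred (<-≤-trans drops bound)))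

    pathBound : ℕ
    pathBound = weigh J.rank cap + weigh merit cap

    -- One bound serves all feasible states; the Markov chain argument needs this uniformity.
    pathToStable : ∀ {k} → Feasibleℕ k → PathToStable pathBound k
    pathToStable F = improvement _ F (weigh-mono J.rank (capacity F))

open IntegralMarket

-- Integers as rationals, and the Archimedean property.

open import Data.Integer as ℤ using (ℤ; +_; -[1+_]; +[1+_])
import Data.Integer.Properties as ℤ
open import Data.Rational hiding (_≟_; ℚ)
open import Data.Rational.Properties hiding (_≟_)
open import Data.Rational.Solver using (module +-*-Solver)
import Data.Rational.Unnormalised as ℚᵘ
import Data.Rational.Unnormalised.Properties as ℚᵘ
open +-*-Solver using (solve; _:+_; _:*_; _:-_; con; _:=_)

-- For a variable `z` the fraction `z / 1` is stuck on a gcd; its unnormalised form computes.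
ι-unnormalised : ∀ z → toℚᵘ (ι z) ℚᵘ.≃ ℚᵘ.mkℚᵘ z 0
ι-unnormalised z = toℚᵘ-fromℚᵘ (ℚᵘ.mkℚᵘ z 0)

ι-+ : ∀ a b → ι (a ℤ.+ b) ≡ ι a + ι b
ι-+ a b = toℚᵘ-injective (begin
  toℚᵘ (ι (a ℤ.+ b))                    ≈⟨ ι-unnormalised (a ℤ.+ b) ⟩
  ℚᵘ.mkℚᵘ (a ℤ.+ b) 0                   ≈⟨ ℚᵘ.*≡* (cong (ℤ._* ℤ.1ℤ) (sym (cong₂ ℤ._+_ (ℤ.*-identityʳ a) (ℤ.*-identityʳ b)))) ⟩
  ℚᵘ.mkℚᵘ a 0 ℚᵘ.+ ℚᵘ.mkℚᵘ b 0          ≈⟨ ℚᵘ.+-cong (ι-unnormalised a) (ι-unnormalised b) ⟨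
  toℚᵘ (ι a) ℚᵘ.+ toℚᵘ (ι b)            ≈⟨ toℚᵘ-homo-+ (ι a) (ι b) ⟨
  toℚᵘ (ι a + ι b)                      ∎)
  where
  open ℚᵘ.≃-Reasoning

ι-neg : ∀ a → ι (ℤ.- a) ≡ - ι a
ι-neg (+ zero)   = refl
ι-neg (+ suc n)  = refl
ι-neg -[1+ n ]   = sym (⁻¹-involutive (ι (+ suc n)))
  where open import Algebra.Properties.Group +-0-group

archimedean : ∀ r {u} → 0ℚ < u → ∃ λ n → r < ι (+ n) * u
archimedean r@(mkℚ -[1+ _ ] _ _) {u} _ = 0 , subst (r <_) (sym (*-zeroˡ u)) (negative⁻¹ r)
archimedean r@(mkℚ (+ a) d _) {u@(mkℚ +[1+ p ] c _)} _ = n , toℚᵘ-cancel-< (ℚᵘ.<-respʳ-≃ product (ℚᵘ.*<* ineq))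
  where
  n : ℕ
  -- With `r = a/(d+1)` and `u = (p+1)/(c+1)`, cross-multiplication asks for
  -- `a (c+1) < n (p+1) (d+1)`; already `a (c+1) < n` holds.
  n = suc a ℕ.* suc c
  product : ℚᵘ.mkℚᵘ (+ n) 0 ℚᵘ.* toℚᵘ u ℚᵘ.≃ toℚᵘ (ι (+ n) * u)
  product = ℚᵘ.≃-sym (ℚᵘ.≃-trans (toℚᵘ-homo-* (ι (+ n)) u) (ℚᵘ.*-congʳ {toℚᵘ u} (ι-unnormalised (+ n))))
  ineq : + a ℤ.* + (1 ℕ.* suc c) ℤ.< (+ n ℤ.* + suc p) ℤ.* + suc d
  ineq = subst₂ ℤ._<_ (ℤ.pos-* a (1 ℕ.* suc c))
    (trans (ℤ.pos-* (n ℕ.* suc p) (suc d)) (cong (ℤ._* + suc d) (ℤ.pos-* n (suc p)))) (ℤ.+<+ (begin-strict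
    a ℕ.* (1 ℕ.* suc c)           ≡⟨ cong (a ℕ.*_) (ℕ.*-identityˡ (suc c)) ⟩
    a ℕ.* suc c                   <⟨ ℕ.m<n+m _ ℕ.z<s ⟩
    n                             ≤⟨ ℕ.m≤m*n n (suc p) ⟩
    n ℕ.* suc p                   ≤⟨ ℕ.m≤m*n _ (suc d) ⟩
    n ℕ.* suc p ℕ.* suc d         ∎))
    where open ℕ.≤-Reasoning
archimedean (mkℚ (+ _) _ _) {mkℚ (+ zero) _ _} (*<* (ℤ.+<+ ()))
archimedean (mkℚ (+ _) _ _) {mkℚ -[1+ _ ] _ _} (*<* ())

p≤q⇒0≤q-p : ∀ {p q} → p ≤ q → 0ℚ ≤ q - p
p≤q⇒0≤q-p {p} {q} p≤q = subst (_≤ q - p) (+-inverseʳ p) (+-monoˡ-≤ (- p) p≤q)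

p-q≤p : ∀ {p q} → 0ℚ ≤ q → p - q ≤ p
p-q≤p {p} {q} 0≤q = subst (p - q ≤_) (+-identityʳ p) (+-monoʳ-≤ p (neg-antimono-≤ 0≤q))

*-mono₂ : ∀ {p q} r → 0ℚ ≤ r → p ≤ q → r * p ≤ r * q
*-mono₂ r 0≤r = *-monoˡ-≤-nonNeg r {{nonNegative 0≤r}}

0≤* : ∀ {p q} → 0ℚ ≤ p → 0ℚ ≤ q → 0ℚ ≤ p * q
0≤* {p} {q} 0≤p 0≤q = subst (_≤ p * q) (*-zeroʳ p) (*-mono₂ p 0≤p 0≤q)

0<* : ∀ {p q} → 0ℚ < p → 0ℚ < q → 0ℚ < p * q
0<* {p} {q} 0<p 0<q = subst (_< p * q) (*-zeroʳ p) (*-monoʳ-<-pos p {{positive 0<p}} 0<q)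

-- Natural multiples of the unit `u`.

module Scale {u} (0<u : 0ℚ < u) where
  opaque
    -- Opaque, so that multiples of `u` do not unfold into rational arithmetic; outside the block
    -- only the laws proved here are available.
    ⟦_⟧ : ℕ → ℚ
    ⟦ n ⟧ = ι (+ n) * u

    ⟦⟧-def : ∀ n → ⟦ n ⟧ ≡ ι (+ n) * u
    ⟦⟧-def n = refl

    ⟦⟧-0 : ⟦ 0 ⟧ ≡ 0ℚ
    ⟦⟧-0 = *-zeroˡ u

    ⟦⟧-1 : ⟦ 1 ⟧ ≡ u
    ⟦⟧-1 = *-identityˡ u

    ⟦⟧-+ : ∀ m n → ⟦ m ℕ.+ n ⟧ ≡ ⟦ m ⟧ + ⟦ n ⟧
    ⟦⟧-+ m n = trans (cong (_* u) (ι-+ (+ m) (+ n))) (*-distribʳ-+ u (ι (+ m)) (ι (+ n)))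

    0<⟦suc⟧ : ∀ n → 0ℚ < ⟦ suc n ⟧
    0<⟦suc⟧ n = 0<* (positive⁻¹ (ι (+ suc n)) {{normalize-pos (suc n) 1}}) 0<u

  ⟦⟧-mono-< : ∀ {m n} → m ℕ.< n → ⟦ m ⟧ < ⟦ n ⟧
  ⟦⟧-mono-< {m} m<n with ℕ.m≤n⇒∃[o]m+o≡n m<n
  ... | o , refl = subst₂ _<_ (+-identityʳ ⟦ m ⟧) (trans (sym (⟦⟧-+ m (suc o))) (cong ⟦_⟧ (ℕ.+-suc m o)))
                     (+-monoʳ-< ⟦ m ⟧ (0<⟦suc⟧ o))

  ⟦⟧-mono-≤ : ∀ {m n} → m ℕ.≤ n → ⟦ m ⟧ ≤ ⟦ n ⟧
  ⟦⟧-mono-≤ m≤n with ℕ.m≤n⇒m<n∨m≡n m≤n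
  ... | inj₁ m<n  = <⇒≤ (⟦⟧-mono-< m<n)
  ... | inj₂ refl = ≤-refl

  ⟦⟧-cancel-< : ∀ {m n} → ⟦ m ⟧ < ⟦ n ⟧ → m ℕ.< n
  ⟦⟧-cancel-< lt = ℕ.≰⇒> λ n≤m → <-irrefl refl (<-≤-trans lt (⟦⟧-mono-≤ n≤m))

  ⟦⟧-cancel-≤ : ∀ {m n} → ⟦ m ⟧ ≤ ⟦ n ⟧ → m ℕ.≤ n
  ⟦⟧-cancel-≤ le = ℕ.≮⇒≥ λ n<m → <-irrefl refl (<-≤-trans (⟦⟧-mono-< n<m) le)

  ⟦⟧-positive : ∀ {n} → 0ℚ < ⟦ n ⟧ → 0 ℕ.< n
  ⟦⟧-positive {n} 0<n = ⟦⟧-cancel-< (subst (_< ⟦ n ⟧) (sym ⟦⟧-0) 0<n)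

  ⟦⟧-nonNegative : ∀ n → 0ℚ ≤ ⟦ n ⟧
  ⟦⟧-nonNegative n = subst (_≤ ⟦ n ⟧) ⟦⟧-0 (⟦⟧-mono-≤ ℕ.z≤n)

  natural-multiple : ∀ z → 0ℚ ≤ ι z * u → ∃ λ n → ι z * u ≡ ⟦ n ⟧
  natural-multiple (+ n)    _  = n , sym (⟦⟧-def n)
  natural-multiple -[1+ n ] 0≤ = contradiction
    (subst (0ℚ ≤_) unfold 0≤)
    (λ 0≤- → <-irrefl refl (<-≤-trans (neg-antimono-< (0<⟦suc⟧ n)) 0≤-))
    where
    open ≡-Reasoning
    unfold : ι -[1+ n ] * u ≡ - ⟦ suc n ⟧
    unfold = begin
      ι -[1+ n ] * u           ≡⟨ cong (_* u) (ι-neg (+ suc n)) ⟩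
      - ι (+ suc n) * u        ≡⟨ neg-distribˡ-* (ι (+ suc n)) u ⟨
      - (ι (+ suc n) * u)      ≡⟨ cong -_ (⟦⟧-def (suc n)) ⟨
      - ⟦ suc n ⟧              ∎

-- Integer combinations of the data.

Σᶠ-cong : ∀ n {f g : Fin n → ℚ} → (∀ i → f i ≡ g i) → Σᶠ n f ≡ Σᶠ n g
Σᶠ-cong zero    f≗g = refl
Σᶠ-cong (suc n) f≗g = cong₂ _+_ (f≗g zero) (Σᶠ-cong n (f≗g ∘ suc))

Σᶠ-0 : ∀ n {f : Fin n → ℚ} → (∀ i → f i ≡ 0ℚ) → Σᶠ n f ≡ 0ℚ
Σᶠ-0 zero    f≗0 = refl
Σᶠ-0 (suc n) f≗0 = cong₂ _+_ (f≗0 zero) (Σᶠ-0 n (f≗0 ∘ suc))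

Σᶠ-- : ∀ n (f g : Fin n → ℚ) → Σᶠ n f - Σᶠ n g ≡ Σᶠ n (λ i → f i - g i)
Σᶠ-- zero    f g = refl
Σᶠ-- (suc n) f g = trans
  (solve 4 (λ a b c d → (a :+ b) :- (c :+ d) := (a :- c) :+ (b :- d)) refl
     (f zero) (Σᶠ n (f ∘ suc)) (g zero) (Σᶠ n (g ∘ suc)))
  (cong (λ s → (f zero - g zero) + s) (Σᶠ-- n (f ∘ suc) (g ∘ suc)))

combine : ∀ {n} → (Fin n → ℤ) → (Fin n → ℚ) → ℚ
combine a f = Σᶠ _ (λ i → ι (a i) * f i)

combine-- : ∀ {n} a b (f : Fin n → ℚ) → combine a f - combine b f ≡ combine (λ i → a i ℤ.- b i) f
combine-- {n} a b f = trans (Σᶠ-- n _ _) (Σᶠ-cong n λ i → begin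
  ι (a i) * f i - ι (b i) * f i        ≡⟨ solve 3 (λ a b x → a :* x :- b :* x := (a :- b) :* x) refl (ι (a i)) (ι (b i)) (f i) ⟩
  (ι (a i) - ι (b i)) * f i            ≡⟨ cong (λ c → (ι (a i) + c) * f i) (ι-neg (b i)) ⟨
  (ι (a i) + ι (ℤ.- b i)) * f i        ≡⟨ cong (_* f i) (ι-+ (a i) (ℤ.- b i)) ⟨
  ι (a i ℤ.- b i) * f i                ∎)
  where
  open ≡-Reasoning

-- The standard basis vector, with which each single datum becomes an integer combination.
point : ∀ {n} → Fin n → Fin n → ℤ
point zero    zero    = + 1
point zero    (suc _) = + 0
point (suc _) zero    = + 0
point (suc e) (suc i) = point e i

combine-0 : ∀ {n} (f : Fin n → ℚ) → combine (λ _ → + 0) f ≡ 0ℚ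
combine-0 f = Σᶠ-0 _ λ i → *-zeroˡ (f i)

combine-point : ∀ {n} e (f : Fin n → ℚ) → combine (point e) f ≡ f e
combine-point zero    f = trans (cong₂ _+_ (*-identityˡ (f zero)) (combine-0 (f ∘ suc))) (+-identityʳ (f zero))
combine-point (suc e) f = trans (cong₂ _+_ (*-zeroˡ (f zero)) (combine-point e (f ∘ suc))) (+-identityˡ (f (suc e)))

module _ (I : Instance) (x₀ : Allocation I) where
  open Instance I

  combination-- : ∀ {r s} → IntegerCombination I x₀ r → IntegerCombination I x₀ s → IntegerCombination I x₀ (r - s)
  combination-- (a , b , c , d , refl) (a′ , b′ , c′ , d′ , refl) =
    (λ i → a i ℤ.- a′ i) , (λ i → b i ℤ.- b′ i) , (λ i → c i ℤ.- c′ i) , (λ i → d i ℤ.- d′ i) , trans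
    (solve 8 (λ p q r s p′ q′ r′ s′ → (p :+ q :+ r :+ s) :- (p′ :+ q′ :+ r′ :+ s′)
                                   := (p :- p′) :+ (q :- q′) :+ (r :- r′) :+ (s :- s′)) refl
       (combine a qJ) (combine b qM) (combine c cap) (combine d x₀)
       (combine a′ qJ) (combine b′ qM) (combine c′ cap) (combine d′ x₀))
    (cong₂ _+_ (cong₂ _+_ (cong₂ _+_ (combine-- a a′ qJ) (combine-- b b′ qM)) (combine-- c c′ cap)) (combine-- d d′ x₀))

  private
    zeros : ∀ {n} → Fin n → ℤ
    zeros _ = + 0

    datum : ∀ a b c d {p q r s v} → combine a qJ ≡ p → combine b qM ≡ q → combine c cap ≡ r → combine d x₀ ≡ s →
            v ≡ p + q + r + s → IntegerCombination I x₀ v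
    datum a b c d refl refl refl refl eq = a , b , c , d , eq

  qJ-combination : ∀ j → IntegerCombination I x₀ (qJ j)
  qJ-combination j = datum (point j) zeros zeros zeros
    (combine-point j qJ) (combine-0 qM) (combine-0 cap) (combine-0 x₀)
    (solve 1 (λ v → v := v :+ con 0ℚ :+ con 0ℚ :+ con 0ℚ) refl (qJ j))

  qM-combination : ∀ m → IntegerCombination I x₀ (qM m)
  qM-combination m = datum zeros (point m) zeros zeros
    (combine-0 qJ) (combine-point m qM) (combine-0 cap) (combine-0 x₀)
    (solve 1 (λ v → v := con 0ℚ :+ v :+ con 0ℚ :+ con 0ℚ) refl (qM m))

  cap-combination : ∀ e → IntegerCombination I x₀ (cap e)
  cap-combination e = datum zeros zeros (point e) zeros
    (combine-0 qJ) (combine-0 qM) (combine-point e cap) (combine-0 x₀)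
    (solve 1 (λ v → v := con 0ℚ :+ con 0ℚ :+ v :+ con 0ℚ) refl (cap e))

  x₀-combination : ∀ e → IntegerCombination I x₀ (x₀ e)
  x₀-combination e = datum zeros zeros zeros (point e)
    (combine-0 qJ) (combine-0 qM) (combine-0 cap) (combine-point e x₀)
    (solve 1 (λ v → v := con 0ℚ :+ con 0ℚ :+ con 0ℚ :+ v) refl (x₀ e))

  -- Repeatedly subtracting u from an integer combination can only stop at 0, since u is minimal.
  multiple-of-unit : ∀ {u} ((0<u , _) : IsStepUnit I x₀ u) → ∀ {r} → IntegerCombination I x₀ r → 0ℚ ≤ r →
                     ∃ λ n → r ≡ Scale.⟦_⟧ 0<u n
  -- The Archimedean `N` bounds the number of subtractions and makes the recursion structural.
  multiple-of-unit {u} (0<u , IC-u , minimal) {r} IC-r 0≤r with archimedean r 0<u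
  ... | N , r<Nu = subtract N IC-r 0≤r (subst (r <_) (sym (Scale.⟦⟧-def 0<u N)) r<Nu)
    where
    open Scale 0<u
    subtract : ∀ N {r} → IntegerCombination I x₀ r → 0ℚ ≤ r → r < ⟦ N ⟧ → ∃ λ n → r ≡ ⟦ n ⟧
    subtract zero    {r} IC-r 0≤r r<N = contradiction (<-≤-trans (subst (r <_) ⟦⟧-0 r<N) 0≤r) (<-irrefl refl)
    subtract (suc N) {r} IC-r 0≤r r<N = case 0ℚ <? r of λ where
        (no 0≮r)  → 0 , trans (≤-antisym (≮⇒≥ 0≮r) 0≤r) (sym ⟦⟧-0)
        (yes 0<r) → add-unit (subtract N (combination-- IC-r IC-u) (p≤q⇒0≤q-p (minimal r 0<r IC-r))
                                 (subst (r - u <_) step-down (+-monoˡ-< (- u) r<N)))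
      where
      step-down : ⟦ suc N ⟧ - u ≡ ⟦ N ⟧
      step-down = trans (cong (_- u) (trans (⟦⟧-+ 1 N) (cong (_+ ⟦ N ⟧) ⟦⟧-1)))
                        (solve 2 (λ u n → (u :+ n) :- u := n) refl u ⟦ N ⟧)
      add-unit : (∃ λ n → r - u ≡ ⟦ n ⟧) → ∃ λ n → r ≡ ⟦ n ⟧
      add-unit (n , eq) = suc n , (begin
        r                   ≡⟨ solve 2 (λ r u → r := u :+ (r :- u)) refl r u ⟩
        u + (r - u)         ≡⟨ cong₂ _+_ (sym ⟦⟧-1) eq ⟩
        ⟦ 1 ⟧ + ⟦ n ⟧       ≡⟨ ⟦⟧-+ 1 n ⟨
        ⟦ suc n ⟧           ∎)
        where open ≡-Reasoning

-- The minimum of 1 and the positive entries. Other entries are skipped to keep `δ` positive, and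
-- starting from 1 gives `δ ≤ 1`.
positive-lower-bound : ∀ ps → ∃ λ δ → 0ℚ < δ × δ ≤ 1ℚ × (∀ {p} → p ∈ ps → 0ℚ < p → δ ≤ p)
positive-lower-bound []       = 1ℚ , positive⁻¹ 1ℚ , ≤-refl , λ ()
positive-lower-bound (p ∷ ps) with positive-lower-bound ps | 0ℚ <? p
... | δ , 0<δ , δ≤1 , δ≤ | no 0≮p  = δ , 0<δ , δ≤1 , λ where
  (here refl) 0<p → contradiction 0<p 0≮p
  (there p∈)      → δ≤ p∈
... | δ , 0<δ , δ≤1 , δ≤ | yes 0<p with ≤-total δ p
...   | inj₁ δ≤p = δ , 0<δ , δ≤1 , λ where
  (here refl) _ → δ≤p
  (there p∈)    → δ≤ p∈
...   | inj₂ p≤δ = p , 0<p , ≤-trans p≤δ δ≤1 , λ where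
  (here refl) _   → ≤-refl
  (there p∈) 0<q → ≤-trans p≤δ (δ≤ p∈ 0<q)

-- Expectations over finite weighted lists.

module _ {A : Set} where
  expect : (A → ℚ) → List (A × ℚ) → ℚ
  expect f []             = 0ℚ
  expect f ((y , p) ∷ ps) = p * f y + expect f ps

  module _ {f : A → ℚ} {B : ℚ} where
    open ≤-Reasoning

    private
      head-≤ : ∀ {y p ps} → (∀ {z q} → (z , q) ∈ (y , p) ∷ ps → 0ℚ ≤ q × f z ≤ B) → p * f y ≤ p * B
      head-≤ {p = p} below = let 0≤p , fy≤B = below (here refl) in *-mono₂ p 0≤p fy≤B

    expect-≤ : ∀ ps → (∀ {y p} → (y , p) ∈ ps → 0ℚ ≤ p × f y ≤ B) → expect f ps ≤ sumProb ps * B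
    expect-≤ []             _     = ≤-reflexive (sym (*-zeroˡ B))
    expect-≤ ((y , p) ∷ ps) below = begin
      p * f y + expect f ps        ≤⟨ +-mono-≤ (head-≤ below) (expect-≤ ps (below ∘ there)) ⟩
      p * B + sumProb ps * B       ≡⟨ *-distribʳ-+ B p (sumProb ps) ⟨
      (p + sumProb ps) * B         ∎

    -- A single outcome lying `d` below the common bound saves its weight times `d`; this produces
    -- the geometric decay.
    expect-drop : ∀ ps → (∀ {y p} → (y , p) ∈ ps → 0ℚ ≤ p × f y ≤ B) →
                  ∀ {y p d} → (y , p) ∈ ps → f y ≤ B - d → expect f ps ≤ sumProb ps * B - p * d
    expect-drop ((y , p) ∷ ps) below {d = d} (here refl) drop = begin
      p * f y + expect f ps                ≤⟨ +-mono-≤ (*-mono₂ p (proj₁ (below (here refl))) drop) (expect-≤ ps (below ∘ there)) ⟩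
      p * (B - d) + sumProb ps * B         ≡⟨ solve 4 (λ p b d s → p :* (b :- d) :+ s :* b := (p :+ s) :* b :- p :* d)
                                                     refl p B d (sumProb ps) ⟩
      (p + sumProb ps) * B - p * d         ∎
    expect-drop ((y , p) ∷ ps) below {p = q} {d} (there y∈) drop = begin
      p * f y + expect f ps                ≤⟨ +-mono-≤ (head-≤ below) (expect-drop ps (below ∘ there) y∈ drop) ⟩
      p * B + (sumProb ps * B - q * d)     ≡⟨ solve 4 (λ p b c s → p :* b :+ (s :* b :- c) := (p :+ s) :* b :- c)
                                                     refl p B (q * d) (sumProb ps) ⟩
      (p + sumProb ps) * B - q * d         ∎

-- Almost sure absorption when transition probabilities are bounded below.

module MarkovChain {A : Set} (K : A → List (A × ℚ)) (State : A → Set) {δ : ℚ} (0<δ : 0ℚ < δ) (δ≤1 : δ ≤ 1ℚ)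
  (closed : ∀ {x y p} → State x → (y , p) ∈ K x → State y × δ ≤ p)
  (total  : ∀ {x} → State x → K x ≢ [] → sumProb (K x) ≡ 1ℚ) where

  -- An absorbing state has the empty list, of expectation 0, so this is the probability that `n`
  -- transitions can be made.
  survival : ℕ → A → ℚ
  survival zero    x = 1ℚ
  survival (suc n) x = expect (survival n) (K x)

  data PathToAbsorption : ℕ → A → Set where
    absorbed : ∀ {n x} → K x ≡ [] → PathToAbsorption n x
    follow   : ∀ {n x y p} → (y , p) ∈ K x → PathToAbsorption n y → PathToAbsorption (suc n) x

  Bound : ℕ → ℚ → Set
  Bound N B = 0ℚ ≤ B × (∀ {x} → State x → survival N x ≤ B)

  private
    below : ∀ N {B x} → Bound N B → State x → ∀ {y p} → (y , p) ∈ K x → 0ℚ ≤ p × survival N y ≤ B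
    below N (_ , bnd) s y∈ = ≤-trans (<⇒≤ 0<δ) (proj₂ (closed s y∈)) , bnd (proj₁ (closed s y∈))

    total-∈ : ∀ {x y} → State x → y ∈ K x → sumProb (K x) ≡ 1ℚ
    total-∈ s y∈ = total s λ eq → no-member (subst (_ ∈_) eq y∈)
      where
      no-member : ∀ {y : A × ℚ} → ¬ y ∈ []
      no-member ()

    absorbed-0 : ∀ N {x} → K x ≡ [] → survival (suc N) x ≡ 0ℚ
    absorbed-0 N eq = cong (expect (survival N)) eq

  -- One more transition averages values below `B` with total mass 1, or gives 0.
  bound-suc : ∀ N {B} → Bound N B → Bound (suc N) B
  bound-suc N {B} bnd@(0≤B , _) = 0≤B , λ {x} s → cases s (K x) refl
    where
    cases : ∀ {x} → State x → ∀ ps → K x ≡ ps → survival (suc N) x ≤ B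
    cases s []      eq = subst (_≤ B) (sym (absorbed-0 N eq)) 0≤B
    cases {x} s (_ ∷ _) eq = begin
      expect (survival N) (K x)   ≤⟨ expect-≤ (K x) (below N bnd s) ⟩
      sumProb (K x) * B           ≡⟨ cong (_* B) (total s λ eq′ → case trans (sym eq) eq′ of λ ()) ⟩
      1ℚ * B                      ≡⟨ *-identityˡ B ⟩
      B                           ∎
      where
      open ≤-Reasoning

  bound-+ : ∀ n N {B} → Bound N B → Bound (n ℕ.+ N) B
  bound-+ zero    N bnd = bnd
  bound-+ (suc n) N bnd = bound-suc (n ℕ.+ N) (bound-+ n N bnd)

  δ^_ : ℕ → ℚ
  δ^ zero  = 1ℚ
  δ^ suc n = δ * δ^ n

  0<δ^ : ∀ n → 0ℚ < δ^ n
  0<δ^ zero    = positive⁻¹ 1ℚ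
  0<δ^ (suc n) = 0<* 0<δ (0<δ^ n)

  δ^≤1 : ∀ n → δ^ n ≤ 1ℚ
  δ^≤1 zero    = ≤-refl
  δ^≤1 (suc n) = ≤-trans (*-mono₂ δ (<⇒≤ 0<δ) (δ^≤1 n)) (≤-trans (≤-reflexive (*-identityʳ δ)) δ≤1)

  -- Each transition of the path has probability at least `δ`, so a share `δ^ n` of the bound is
  -- lost at its end, while all side branches stay below `B`. The extra step is there because
  -- `survival zero` is 1 even at absorbing states.
  contraction : ∀ N {B} → Bound N B → ∀ n {x} → State x → PathToAbsorption n x →
                survival (suc n ℕ.+ N) x ≤ B - B * δ^ n
  contraction N {B} (0≤B , _) n _ (absorbed eq) =
    subst (_≤ B - B * δ^ n) (sym (absorbed-0 (n ℕ.+ N) eq))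
      (p≤q⇒0≤q-p (≤-trans (*-mono₂ B 0≤B (δ^≤1 n)) (≤-reflexive (*-identityʳ B))))
  contraction N {B} bnd@(0≤B , _) (suc n) {x} s (follow {y = y} {p} y∈ path) = begin
    expect (survival (suc n ℕ.+ N)) (K x)     ≤⟨ expect-drop (K x) (below (suc n ℕ.+ N) (bound-+ (suc n) N bnd) s) y∈
                                                   (contraction N bnd n (proj₁ (closed s y∈)) path) ⟩
    sumProb (K x) * B - p * (B * δ^ n)        ≡⟨ cong (λ t → t * B - p * (B * δ^ n)) (total-∈ s y∈) ⟩
    1ℚ * B - p * (B * δ^ n)                   ≤⟨ +-monoʳ-≤ (1ℚ * B) (neg-antimono-≤ (*-monoʳ-≤-nonNeg (B * δ^ n) (proj₂ (closed s y∈)))) ⟩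
    1ℚ * B - δ * (B * δ^ n)                   ≡⟨ solve 3 (λ d b t → con 1ℚ :* b :- d :* (b :* t) := b :- b :* (d :* t)) refl δ B (δ^ n) ⟩
    B - B * δ^ suc n                          ∎
    where
    open ≤-Reasoning
    instance _ = nonNegative (0≤* 0≤B (<⇒≤ (0<δ^ n)))

  module _ {L} (path : ∀ {x} → State x → PathToAbsorption L x) where
    private
      η = δ^ L

    -- Bernoulli's inequality for (1 − η)^k, in the product form B (1 + k η) ≤ 1.
    decay : ∀ k → ∃₂ λ N B → Bound N B × B * (1ℚ + ι (+ k) * η) ≤ 1ℚ
    decay zero = 0 , 1ℚ , (<⇒≤ (positive⁻¹ 1ℚ) , λ _ → ≤-refl)
               , ≤-reflexive (trans (*-identityˡ _) (trans (cong (λ c → 1ℚ + c) (*-zeroˡ η)) (+-identityʳ 1ℚ)))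
    decay (suc k) with decay k
    ... | N , B , bnd@(0≤B , _) , B≤ = suc L ℕ.+ N , B - B * η
        , ( p≤q⇒0≤q-p (≤-trans (*-mono₂ B 0≤B (δ^≤1 L)) (≤-reflexive (*-identityʳ B)))
          , λ s → contraction N bnd L s (path s))
        , (begin
      (B - B * η) * (1ℚ + ι (+ suc k) * η)    ≡⟨ cong (λ c → (B - B * η) * (1ℚ + c * η)) (ι-+ (+ 1) (+ k)) ⟩
      -- Expansion yields the previous product minus a nonnegative term of second order in `η`.
      (B - B * η) * (1ℚ + (1ℚ + c) * η)       ≡⟨ solve 3 (λ b e c → (b :- b :* e) :* (con 1ℚ :+ (con 1ℚ :+ c) :* e)
                                                                := b :* (con 1ℚ :+ c :* e) :- b :* ((con 1ℚ :+ c) :* (e :* e)))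
                                                       refl B η c ⟩
      B * (1ℚ + c * η) - B * ((1ℚ + c) * (η * η))  ≤⟨ p-q≤p (0≤* 0≤B (0≤* 0≤1+c 0≤η²)) ⟩
      B * (1ℚ + c * η)                        ≤⟨ B≤ ⟩
      1ℚ                                      ∎)
      where
      open ≤-Reasoning
      c = ι (+ k)
      0≤η² : 0ℚ ≤ η * η
      0≤η² = <⇒≤ (0<* (0<δ^ L) (0<δ^ L))
      0≤1+c : 0ℚ ≤ 1ℚ + c
      0≤1+c = +-mono-≤ (<⇒≤ (positive⁻¹ 1ℚ)) (nonNegative⁻¹ c {{normalize-nonNeg k 1}})

    -- Choose `k` with `1 < k ε η`. Then `ε ≤ B` would give `1 < B (1 + k η)`, against the bound
    -- from `decay`.
    absorbed-almost-surely : ∀ ε → 0ℚ < ε → ∃ λ N → ∀ {x} → State x → survival N x < ε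
    absorbed-almost-surely ε 0<ε with archimedean 1ℚ (0<* 0<ε (0<δ^ L))
    ... | k , 1<kεη with decay k
    ...   | N , B , (0≤B , bnd) , B≤ = N , λ s → ≤-<-trans (bnd s) (≰⇒> λ ε≤B → <-irrefl refl (begin-strict
      1ℚ                            <⟨ 1<kεη ⟩
      c * (ε * η)                   ≡⟨ solve 3 (λ c e t → c :* (e :* t) := e :* (c :* t)) refl c ε η ⟩
      ε * (c * η)                   ≤⟨ *-monoʳ-≤-nonNeg (c * η) {{nonNegative 0≤cη}} ε≤B ⟩
      B * (c * η)                   ≤⟨ *-mono₂ B 0≤B (subst (_≤ 1ℚ + c * η) (+-identityˡ _) (+-monoˡ-≤ (c * η) (<⇒≤ (positive⁻¹ 1ℚ)))) ⟩
      B * (1ℚ + c * η)              ≤⟨ B≤ ⟩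
      1ℚ                            ∎))
      where
      open ≤-Reasoning
      c = ι (+ k)
      0≤cη : 0ℚ ≤ c * η
      0≤cη = 0≤* (nonNegative⁻¹ c {{normalize-nonNeg k 1}}) (<⇒≤ (0<δ^ L))

-- Enumeration of bounded integer vectors; unfolding loads and running probabilities.

box : ∀ {n} → (Fin n → ℕ) → List (Fin n → ℕ)
box {zero}  c = (λ ()) ∷ []
box {suc n} c = cartesianProductWith Vector._∷_ (upTo (suc (c zero))) (box (c ∘ suc))

-- Membership holds only for a pointwise equal copy, since vectors are functions.
box-complete : ∀ {n} {c k : Fin n → ℕ} → (∀ i → k i ℕ.≤ c i) → ∃ λ l → l ∈ box c × (∀ i → k i ≡ l i)
box-complete {zero}          k≤c = (λ ()) , here refl , λ ()
box-complete {suc n} {c} {k} k≤c with box-complete (k≤c ∘ suc)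
... | l , l∈ , k≗l = k zero Vector.∷ l , ∈-cartesianProductWith⁺ Vector._∷_ (∈-upTo⁺ (ℕ.s≤s (k≤c zero))) l∈ , λ where
  zero    → refl
  (suc i) → k≗l i

∈-concatMap : ∀ {A B : Set} (f : A → List B) {x y xs} → x ∈ xs → y ∈ f x → y ∈ concatMap f xs
∈-concatMap f x∈ y∈ = ∈-concatMap⁺ f (lose x∈ y∈)

-- The underscores stand for the local functions indJ, indM and go, which cannot be named outside Defs.
mutual
  loadJ-if : ∀ I x j → loadJ I x j ≡ Σᶠ _ (λ e → if does (Instance.jobOf I e ≟ j) then x e else 0ℚ)
  loadJ-if I x j = Σᶠ-cong _ (loadJ-summand I x j)

  loadJ-summand : ∀ I x j e → _ ≡ (if does (Instance.jobOf I e ≟ j) then x e else 0ℚ)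
  loadJ-summand I x j e with Instance.jobOf I e ≟ j
  ... | yes _ = refl
  ... | no  _ = refl

mutual
  loadM-if : ∀ I x m → loadM I x m ≡ Σᶠ _ (λ e → if does (Instance.machOf I e ≟ m) then x e else 0ℚ)
  loadM-if I x m = Σᶠ-cong _ (loadM-summand I x m)

  loadM-summand : ∀ I x m e → _ ≡ (if does (Instance.machOf I e ≟ m) then x e else 0ℚ)
  loadM-summand I x m e with Instance.machOf I e ≟ m
  ... | yes _ = refl
  ... | no  _ = refl

mutual
  runningProb-expect : ∀ I K n x → runningProb I K (suc n) x ≡ expect (runningProb I K n) (K x)
  runningProb-expect I K n x with K x
  ... | ps = runningProb-go I K n x ps

  runningProb-go : ∀ I K n x ps → _ ≡ expect (runningProb I K n) ps
  runningProb-go I K n x []             = refl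
  runningProb-go I K n x ((y , p) ∷ ps) = cong (λ s → p * runningProb I K n y + s) (runningProb-go I K n x ps)

expect-cong : ∀ {A : Set} {f g : A → ℚ} → (∀ x → f x ≡ g x) → ∀ ps → expect f ps ≡ expect g ps
expect-cong f≗g []             = refl
expect-cong f≗g ((y , p) ∷ ps) = cong₂ (λ a b → p * a + b) (f≗g y) (expect-cong f≗g ps)

-- Translation between rational and integer allocations.

module Discretisation (I : Instance) {u} (0<u : 0ℚ < u)
  (qJ′ : Fin (Instance.nJ I) → ℕ) (qM′ : Fin (Instance.nM I) → ℕ) (cap′ : Fin (Instance.nE I) → ℕ)
  (qJ≡ : ∀ j → Instance.qJ I j ≡ Scale.⟦_⟧ 0<u (qJ′ j)) (qM≡ : ∀ m → Instance.qM I m ≡ Scale.⟦_⟧ 0<u (qM′ m))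
  (cap≡ : ∀ e → Instance.cap I e ≡ Scale.⟦_⟧ 0<u (cap′ e)) where

  open Scale 0<u
  open Instance I

  market : Market
  market = record
    { jobs     = record { end = jobOf ; quota = qJ′ ; rank = rankJ }
    ; machines = record { end = machOf ; quota = qM′ ; rank = rankM }
    ; cap      = cap′
    ; simple   = simple
    }

  open Dynamics market hiding (simple; cap; jobs; machines; edges) public

  infix 4 _≐_
  _≐_ : Allocation I → State → Set
  x ≐ k = ∀ e → x e ≡ ⟦ k e ⟧

  scaled : State → Allocation I
  scaled k e = ⟦ k e ⟧

  Σ-scaled : ∀ {n} (b : Fin n → Bool) {x : Fin n → ℚ} {k : Fin n → ℕ} → (∀ e → x e ≡ ⟦ k e ⟧) →
             Σᶠ n (λ e → if b e then x e else 0ℚ) ≡ ⟦ weigh (λ e → if b e then 1 else 0) k ⟧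
  Σ-scaled {zero}  b x≐k = sym ⟦⟧-0
  Σ-scaled {suc n} b {x} {k} x≐k = trans (cong₂ _+_ (head (b zero)) (Σ-scaled (b ∘ suc) (x≐k ∘ suc)))
                                         (sym (⟦⟧-+ ((if b zero then 1 else 0) ℕ.* k zero) _))
    where
    head : ∀ c → (if c then x zero else 0ℚ) ≡ ⟦ (if c then 1 else 0) ℕ.* k zero ⟧
    head true  = trans (x≐k zero) (cong ⟦_⟧ (sym (ℕ.+-identityʳ (k zero))))
    head false = sym ⟦⟧-0

  module _ {x k} (x≐k : x ≐ k) where
    loadJ≡ : ∀ j → loadJ I x j ≡ ⟦ J.load k j ⟧
    loadJ≡ j = trans (loadJ-if I x j) (Σ-scaled (λ e → does (jobOf e ≟ j)) x≐k)

    loadM≡ : ∀ m → loadM I x m ≡ ⟦ M.load k m ⟧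
    loadM≡ m = trans (loadM-if I x m) (Σ-scaled (λ e → does (machOf e ≟ m)) x≐k)

    feasible-to : Feasible I x → Feasibleℕ k
    feasible-to (bounds , okJ , okM) = feasible
      (λ e → ⟦⟧-cancel-≤ (subst₂ _≤_ (x≐k e) (cap≡ e) (proj₂ (bounds e))))
      (λ j → ⟦⟧-cancel-≤ (subst₂ _≤_ (loadJ≡ j) (qJ≡ j) (okJ j)))
      (λ m → ⟦⟧-cancel-≤ (subst₂ _≤_ (loadM≡ m) (qM≡ m) (okM m)))

    feasible-from : Feasibleℕ k → Feasible I x
    feasible-from F =
        (λ e → subst (0ℚ ≤_) (sym (x≐k e)) (⟦⟧-nonNegative (k e))
             , subst₂ _≤_ (sym (x≐k e)) (sym (cap≡ e)) (⟦⟧-mono-≤ (capacity F e)))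
      , (λ j → subst₂ _≤_ (sym (loadJ≡ j)) (sym (qJ≡ j)) (⟦⟧-mono-≤ (quotaJ F j)))
      , (λ m → subst₂ _≤_ (sym (loadM≡ m)) (sym (qM≡ m)) (⟦⟧-mono-≤ (quotaM F m)))

    used-to : ∀ {f} → 0ℚ < x f → 0 ℕ.< k f
    used-to {f} 0<xf = ⟦⟧-positive {k f} (subst (0ℚ <_) (x≐k f) 0<xf)

    used-from : ∀ {f} → 0 ℕ.< k f → 0ℚ < x f
    used-from {f} 0<kf = subst₂ _<_ ⟦⟧-0 (sym (x≐k f)) (⟦⟧-mono-< {0} {k f} 0<kf)

    blocks-to : ∀ {e} → Blocks I e x → Blocksℕ k e
    blocks-to {e} (e<cap , J , M) =
        ⟦⟧-cancel-< (subst₂ _<_ (x≐k e) (cap≡ e) e<cap)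
      , Sum.map (λ lt → ⟦⟧-cancel-< (subst₂ _<_ (loadJ≡ _) (qJ≡ _) lt))
                (λ (f , same , pos , lt) → f , same , used-to pos , lt) J
      , Sum.map (λ lt → ⟦⟧-cancel-< (subst₂ _<_ (loadM≡ _) (qM≡ _) lt))
                (λ (f , same , pos , lt) → f , same , used-to pos , lt) M

    blocks-from : ∀ {e} → Blocksℕ k e → Blocks I e x
    blocks-from {e} (e<cap , J , M) =
        subst₂ _<_ (sym (x≐k e)) (sym (cap≡ e)) (⟦⟧-mono-< e<cap)
      , Sum.map (λ lt → subst₂ _<_ (sym (loadJ≡ _)) (sym (qJ≡ _)) (⟦⟧-mono-< lt))
                (λ (f , same , pos , lt) → f , same , used-from pos , lt) J
      , Sum.map (λ lt → subst₂ _<_ (sym (loadM≡ _)) (sym (qM≡ _)) (⟦⟧-mono-< lt))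
                (λ (f , same , pos , lt) → f , same , used-from pos , lt) M

  module _ {x y k l} (x≐k : x ≐ k) (y≐l : y ≐ l) where
    private
      ≡-to : ∀ {f} → y f ≡ x f → l f ≡ k f
      ≡-to {f} eq = ℕ.≤-antisym (⟦⟧-cancel-≤ (≤-reflexive eq′)) (⟦⟧-cancel-≤ (≤-reflexive (sym eq′)))
        where
        eq′ : ⟦ l f ⟧ ≡ ⟦ k f ⟧
        eq′ = trans (sym (y≐l f)) (trans eq (x≐k f))

      ≡-from : ∀ {f} → l f ≡ k f → y f ≡ x f
      ≡-from {f} eq = trans (y≐l f) (trans (cong ⟦_⟧ eq) (sym (x≐k f)))

      ≤-to : ∀ {f} → y f ≤ x f → l f ℕ.≤ k f
      ≤-to {f} le = ⟦⟧-cancel-≤ (subst₂ _≤_ (y≐l f) (x≐k f) le)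

      ≤-from : ∀ {f} → l f ℕ.≤ k f → y f ≤ x f
      ≤-from {f} le = subst₂ _≤_ (sym (y≐l f)) (sym (x≐k f)) (⟦⟧-mono-≤ le)

      difference : ∀ f → y f - x f ≡ ι (+ l f ℤ.- + k f) * u
      difference f = begin
        y f - x f                               ≡⟨ cong₂ _-_ (trans (y≐l f) (⟦⟧-def (l f))) (trans (x≐k f) (⟦⟧-def (k f))) ⟩
        ι (+ l f) * u - ι (+ k f) * u           ≡⟨ solve 3 (λ a b u → a :* u :- b :* u := (a :- b) :* u) refl (ι (+ l f)) (ι (+ k f)) u ⟩
        (ι (+ l f) - ι (+ k f)) * u             ≡⟨ cong (λ c → (ι (+ l f) + c) * u) (ι-neg (+ k f)) ⟨
        (ι (+ l f) + ι (ℤ.- + k f)) * u         ≡⟨ cong (_* u) (ι-+ (+ l f) (ℤ.- + k f)) ⟨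
        ι (+ l f ℤ.- + k f) * u                 ∎
        where open ≡-Reasoning

    step-to : BetterResponse I u x y → Step k l
    step-to (e , b , lt , lowJ , lowM , keep , _ , F) = record
      { edge    = e
      ; blocks  = blocks-to x≐k b
      ; raises  = ⟦⟧-cancel-< (subst₂ _<_ (x≐k e) (y≐l e) lt)
      ; lowersJ = λ f f≢e same → let le , pref = lowJ f f≢e same in ≤-to le , λ ne → pref (ne ∘ ≡-to)
      ; lowersM = λ f f≢e same → let le , pref = lowM f f≢e same in ≤-to le , λ ne → pref (ne ∘ ≡-to)
      ; keeps   = λ f offJ offM → ≡-to (keep f offJ offM)
      ; remains = feasible-to y≐l F
      }

    -- The restriction to multiples of `u` holds because both allocations are integral in units of
    -- `u`.
    step-from : Step k l → BetterResponse I u x y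
    step-from st = edge , blocks-from x≐k blocks
      , subst₂ _<_ (sym (x≐k edge)) (sym (y≐l edge)) (⟦⟧-mono-< raises)
      , (λ f f≢e same → let le , pref = lowersJ f f≢e same in ≤-from le , λ ne → pref (ne ∘ ≡-from))
      , (λ f f≢e same → let le , pref = lowersM f f≢e same in ≤-from le , λ ne → pref (ne ∘ ≡-from))
      , (λ f offJ offM → ≡-from (keeps f offJ offM))
      , (λ f → + l f ℤ.- + k f , difference f)
      , feasible-from y≐l remains
      where open Step st

  -- `y f` is the sum of the change and `x f`, an integer multiple of `u`; feasibility makes it
  -- nonnegative, hence a natural multiple.
  representable-step : ∀ {x y k} → x ≐ k → BetterResponse I u x y → ∃ (y ≐_)
  representable-step {x} {y} {k} x≐k (_ , _ , _ , _ , _ , _ , multiple , (bounds , _)) =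
    (λ f → proj₁ (value f)) , (λ f → proj₂ (value f))
    where
    value : ∀ f → ∃ λ n → y f ≡ ⟦ n ⟧
    value f = let n , eq = natural-multiple (z ℤ.+ + k f) (subst (0ℚ ≤_) y≡ (proj₁ (bounds f))) in n , trans y≡ eq
      where
      z : ℤ
      z = proj₁ (multiple f)
      y≡ : y f ≡ ι (z ℤ.+ + k f) * u
      y≡ = begin
        y f                            ≡⟨ solve 2 (λ y x → y := (y :- x) :+ x) refl (y f) (x f) ⟩
        (y f - x f) + x f              ≡⟨ cong₂ _+_ (proj₂ (multiple f)) (trans (x≐k f) (⟦⟧-def (k f))) ⟩
        ι z * u + ι (+ k f) * u        ≡⟨ *-distribʳ-+ u (ι z) (ι (+ k f)) ⟨
        (ι z + ι (+ k f)) * u          ≡⟨ cong (_* u) (ι-+ z (+ k f)) ⟨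
        ι (z ℤ.+ + k f) * u            ∎
        where open ≡-Reasoning

  -- The dynamics as a Markov chain with finitely many relevant lists.

  module RandomDynamics {x₀ k₀} (x₀≐k₀ : x₀ ≐ k₀) (F₀ : Feasible I x₀) (K : Kernel I) (brd : IsRandomBRD I u x₀ K) where

    Reach : Allocation I → Set
    Reach = Reachable I u x₀

    reach-feasible : ∀ {x} → Reach x → Feasible I x
    reach-feasible start                                   = F₀
    reach-feasible (step _ (_ , _ , _ , _ , _ , _ , _ , F)) = F

    representable : ∀ {x} → Reach x → ∃ (x ≐_)
    representable start       = _ , x₀≐k₀
    representable (step r br) = representable-step (proj₂ (representable r)) br

    ∈K⇒step : ∀ {x y p} → Reach x → (y , p) ∈ K x → BetterResponse I u x y × 0ℚ < p
    ∈K⇒step r y∈ = All.lookup (proj₁ (brd _ r)) y∈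

    step⇒∈K : ∀ {x y} → Reach x → BetterResponse I u x y → ∃ λ p → (y , p) ∈ K x
    step⇒∈K r = proj₁ (proj₂ (brd _ r)) _

    -- Without function extensionality pointwise equal allocations need not be equal. Still, the finite list K x
    -- contains all copies of every better response from x, and unless x = x₀, x can be replaced by
    -- its copy that comes from an element of the box.
    sources : List (Allocation I)
    sources = x₀ ∷ map scaled (box cap′)

    states : List (Allocation I)
    states = x₀ ∷ concatMap (map proj₁ ∘ K) sources

    supported : ∀ {x y} → x ∈ sources → Reach x → BetterResponse I u x y → y ∈ concatMap (map proj₁ ∘ K) sources
    supported x∈ r br = ∈-concatMap (map proj₁ ∘ K) x∈ (∈-map⁺ proj₁ (proj₂ (step⇒∈K r br)))

    reach⇒∈states : ∀ {x} → Reach x → x ∈ states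
    reach⇒∈states start = here refl
    reach⇒∈states (step start br) = there (supported (here refl) start br)
    reach⇒∈states (step {x} {y} (step {w} r br₁) br₂) =
      let _ , w≐ = representable r
          _ , x≐ = representable (step r br₁)
          _ , y≐ = representable (step (step r br₁) br₂)
          l , l∈ , k≗l = box-complete (capacity (feasible-to x≐ (reach-feasible (step r br₁))))
          x≐l : x ≐ l
          x≐l = λ e → trans (x≐ e) (cong ⟦_⟧ (k≗l e))
          -- The copy `scaled l` of `x` is itself reachable through `w`, so `K` is known to list its
          -- better responses, among them `y`.
          br₁′ : BetterResponse I u w (scaled l)
          br₁′ = step-from w≐ (λ _ → refl) (step-to w≐ x≐l br₁)
          br₂′ : BetterResponse I u (scaled l) y
          br₂′ = step-from (λ _ → refl) y≐ (step-to x≐l y≐ br₂)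
      in there (supported (there (∈-map⁺ scaled l∈)) (step r br₁′) br₂′)

    -- Elements of the box may be unreachable and their lists arbitrary, which is why
    -- `positive-lower-bound` has to tolerate entries that are not positive.
    probabilities : List ℚ
    probabilities = concatMap (map proj₂ ∘ K) states

    δ : ℚ
    δ = proj₁ (positive-lower-bound probabilities)

    closed : ∀ {x y p} → Reach x → (y , p) ∈ K x → Reach y × δ ≤ p
    closed r y∈ = let br , 0<p = ∈K⇒step r y∈ in
      step r br , proj₂ (proj₂ (proj₂ (positive-lower-bound probabilities)))
                    (∈-concatMap (map proj₂ ∘ K) (reach⇒∈states r) (∈-map⁺ proj₂ y∈)) 0<p

    open MarkovChain K Reach (proj₁ (proj₂ (positive-lower-bound probabilities)))
      (proj₁ (proj₂ (proj₂ (positive-lower-bound probabilities)))) closed (λ r → proj₂ (proj₂ (brd _ r)))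

    runningProb≡survival : ∀ n x → runningProb I K n x ≡ survival n x
    runningProb≡survival zero    x = refl
    runningProb≡survival (suc n) x = trans (runningProb-expect I K n x) (expect-cong (runningProb≡survival n) (K x))

    -- Every entry of `K x` is a better response and so carries a blocking edge.
    stable⇒absorbed : ∀ {x k} → Reach x → x ≐ k → (∀ e → ¬ Blocksℕ k e) → K x ≡ []
    stable⇒absorbed {x} r x≐k stable = cases (K x) (proj₁ (brd x r))
      where
      cases : ∀ ps → All (λ yp → BetterResponse I u x (proj₁ yp) × 0ℚ < proj₂ yp) ps → ps ≡ []
      cases []      _                       = refl
      cases (_ ∷ _) (((e , b , _) , _) All.∷ _) = contradiction (blocks-to x≐k b) (stable e)

    path-to-absorption : ∀ {n x k} → Reach x → x ≐ k → PathToStable n k → PathToAbsorption n x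
    path-to-absorption r x≐k (stop stable) = absorbed (stable⇒absorbed r x≐k stable)
    path-to-absorption r x≐k (go st path)  =
      let br = step-from x≐k (λ _ → refl) st
      in follow (proj₂ (step⇒∈K r br)) (path-to-absorption (step r br) (λ _ → refl) path)

    path : ∀ {x} → Reach x → PathToAbsorption pathBound x
    path r = let _ , x≐k = representable r in
      path-to-absorption r x≐k (pathToStable (feasible-to x≐k (reach-feasible r)))

    terminates : TerminatesAlmostSurely I u x₀ K
    terminates =
        (λ ε 0<ε → let N , small = absorbed-almost-surely path ε 0<ε
                   in N , subst (_< ε) (sym (runningProb≡survival N x₀)) (small start))
      -- A blocking edge always admits an exchange of one unit, so an allocation without better
      -- responses is stable.
      , λ x r none e b → let _ , x≐k = representable r
                             _ , st  = blocked⇒step (feasible-to x≐k (reach-feasible r)) (blocks-to x≐k b)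
                         in none _ (step-from x≐k (λ _ → refl) st)

theorem3 : (I : Instance) (x₀ : Allocation I) → Feasible I x₀ →
    (u : ℚ) → IsStepUnit I x₀ u →
    (K : Kernel I) → IsRandomBRD I u x₀ K →
    TerminatesAlmostSurely I u x₀ K
theorem3 I x₀ F₀ u unit@(0<u , _) K brd = terminates
  where
  open Instance I
  -- Each datum is a nonnegative integer combination, hence a natural multiple of `u`; this yields
  -- the integral market.
  qJ-multiple : ∀ j → ∃ λ n → qJ j ≡ Scale.⟦_⟧ 0<u n
  qJ-multiple j = multiple-of-unit I x₀ unit (qJ-combination I x₀ j) (qJ≥0 j)
  qM-multiple : ∀ m → ∃ λ n → qM m ≡ Scale.⟦_⟧ 0<u n
  qM-multiple m = multiple-of-unit I x₀ unit (qM-combination I x₀ m) (qM≥0 m)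
  cap-multiple : ∀ e → ∃ λ n → cap e ≡ Scale.⟦_⟧ 0<u n
  cap-multiple e = multiple-of-unit I x₀ unit (cap-combination I x₀ e) (cap≥0 e)
  x₀-multiple : ∀ e → ∃ λ n → x₀ e ≡ Scale.⟦_⟧ 0<u n
  x₀-multiple e = multiple-of-unit I x₀ unit (x₀-combination I x₀ e) (proj₁ (proj₁ F₀ e))
  open Discretisation I 0<u (proj₁ ∘ qJ-multiple) (proj₁ ∘ qM-multiple) (proj₁ ∘ cap-multiple)
    (proj₂ ∘ qJ-multiple) (proj₂ ∘ qM-multiple) (proj₂ ∘ cap-multiple)
  open RandomDynamics (proj₂ ∘ x₀-multiple) F₀ K brd
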